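{- There exists an absolute constant $C$ such that for every integer $m>C$ there is no primitive regular ternary $m$-gonal form $\triangle_{m,(a,b,c)}$ with $(a,b,c)\in\mathbb{N}^3$.
   Context: For an integer $m\ge 3$ and $x\in\mathbb{Z}$, $p_m(x):=((m-2)x^2-(m-4)x)/2$ is the $x$-th generalized $m$-gonal number. For $a_1,\dots,a_n\in\mathbb{N}$ the $m$-gonal form is $\triangle_{m,(a_1,\dots,a_n)}(x_1,\dots,x_n):=\sum_{i=1}^n a_i p_m(x_i)$; it is ternary when $n=3$ and primitive when $\gcd(a_1,\dots,a_n)=1$. For a ring $R$, a rational number $\ell$ is represented by a polynomial $f$ over $R$ if $f(x)=\ell$ has a solution $x\in R^n$. $\ell$ is locally represented by $f$ if it is represented over $\mathbb{Z}_p$ for every prime $p$ and over $\mathbb{R}$; it is globally represented if it is represented over $\mathbb{Z}$. A quadratic polynomial $f$ is regular if it globally represents every rational number that it locally represents. -}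

module Defs where

open import Data.Nat as ℕ using (ℕ; _^_)
open import Data.Integer as ℤ using (ℤ; +_; _+_; _-_; _*_; _/ℕ_; _≤_; -_)
open import Data.Integer.Divisibility using (_∣_)
open import Data.Nat.Primality using (Prime)
open import Data.Product using (Σ; ∃; _×_)
open import Relation.Binary.PropositionalEquality using (_≡_)

-- x-th generalized m-gonal number  p_m(x) = ((m-2)x^2 - (m-4)x)/2.
-- The numerator is always even, so the (floor) division by 2 is exact.
pgon : ℕ → ℤ → ℤ
pgon m x = (((+ m - + 2) * (x * x)) - ((+ m - + 4) * x)) /ℕ 2

tri : ℕ → ℕ → ℕ → ℕ → ℤ → ℤ → ℤ → ℤ
tri m a b c x y z = (+ a * pgon m x + + b * pgon m y) + + c * pgon m z

_≡[mod_]_ : ℤ → ℕ → ℤ → Set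
u ≡[mod q ] v = (+ q) ∣ (u - v)

-- Representation over ℤ_p, with ℤ_p = lim ℤ/p^k ℤ (inverse limit):
-- a point of ℤ_p^3 is a compatible sequence of residues (x_k,y_k,z_k) mod p^k
-- (given by integer representatives), and the equation holds in ℤ_p iff it
-- holds modulo p^k in every component k.
ReprZp : ℕ → ℕ → ℕ → ℕ → ℕ → ℤ → Set
ReprZp p m a b c ℓ =
  Σ (ℕ → ℤ) λ xs → Σ (ℕ → ℤ) λ ys → Σ (ℕ → ℤ) λ zs →
    (∀ k → (xs (ℕ.suc k) ≡[mod p ^ k ] xs k)
         × (ys (ℕ.suc k) ≡[mod p ^ k ] ys k)
         × (zs (ℕ.suc k) ≡[mod p ^ k ] zs k))
    × (∀ k → tri m a b c (xs k) (ys k) (zs k) ≡[mod p ^ k ] ℓ)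

ReprR : ℕ → ℕ → ℕ → ℕ → ℤ → Set
ReprR m a b c ℓ =
  - ((+ a + + b + + c) * ((+ m - + 4) * (+ m - + 4))) ≤ (+ 8 * (+ m - + 2)) * ℓ

LocRepr : ℕ → ℕ → ℕ → ℕ → ℤ → Set
LocRepr m a b c ℓ = (∀ p → Prime p → ReprZp p m a b c ℓ) × ReprR m a b c ℓ

GlobRepr : ℕ → ℕ → ℕ → ℕ → ℤ → Set
GlobRepr m a b c ℓ = ∃ λ x → ∃ λ y → ∃ λ z → tri m a b c x y z ≡ ℓ

-- regular: every locally represented number is globally represented
-- (only integers can be locally represented)
Regular : ℕ → ℕ → ℕ → ℕ → Set
Regular m a b c = ∀ (ℓ : ℤ) → LocRepr m a b c ℓ → GlobRepr m a b c ℓ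

{-# OPTIONS --safe #-}
-- Put k = m - 2. For k ≥ 1 every p_m(x) with x ∈ ℤ is nonnegative, so a form that locally represents a
-- negative integer is not regular. If d is 2 with 4 ∣ k, or an odd prime dividing k, then p_m maps
-- ℤ_d onto itself, so a primitive form represents everything over ℤ_d; hence an integral value
-- of the form at a point of (1/d)ℤ³ is locally represented. If 4 ∣ k, then p_m(1/2) = (1 - k/4)/2 < 0
-- and some subsum of a, b, c is even. Otherwise k = e q with q = 2h + 1 an odd prime; a pigeonhole
-- argument mod q yields s, t with integral value at (s/q, t/q, h/q), and once h/q, where p_m is
-- about -k/8, is given to the largest coefficient, that value is negative.
module Submission where

open import Defs
open import Data.Nat as ℕ using (ℕ; zero; suc; _^_)
import Data.Nat.Properties as ℕₚ
import Data.Nat.Divisibility as ℕᵈ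
open import Data.Nat.GCD using (gcd; gcd-greatest; module Bézout)
open import Data.Nat.Coprimality using (Coprime; coprime-Bézout)
open import Data.Nat.ListAction using (product)
open import Data.Nat.Primality
open import Data.Nat.Primality.Factorisation using (factorise)
open import Data.Fin using (Fin; toℕ; fromℕ<; splitAt; join)
import Data.Fin.Properties as Finₚ
open import Data.Integer as ℤ using (ℤ; +_; 0ℤ; 1ℤ; -[1+_]; _+_; _-_; _*_; -_; _≤_; ∣_∣; _/ℕ_; _%ℕ_; +≤+)
open import Data.Integer.Properties
open import Data.Integer.DivMod using (a≡a%ℕn+[a/ℕn]*n; n%ℕd<d)
open import Data.Integer.Divisibility.Signed
open import Data.Integer.Tactic.RingSolver using (solve-∀)
open import Data.List using ([]; _∷_)
open import Data.List.Relation.Unary.All using (_∷_)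
open import Data.Product using (∃; ∃₂; _×_; _,_; proj₁; proj₂)
open import Data.Sum as Sum using (_⊎_; inj₁; inj₂; [_,_]′)
open import Function using (_∘_)
open import Relation.Nullary using (¬_; Dec; yes; no; contradiction)
open import Relation.Binary.PropositionalEquality

-- Integer arithmetic and the sign of polygonal numbers.

pos-^ : ∀ p n → + (p ^ suc n) ≡ + p * + (p ^ n)
pos-^ p n = pos-* p (p ^ n)

/2-exact : ∀ i → ((+ 2) * i) /ℕ 2 ≡ i
/2-exact i = sym (*-cancelˡ-≡ (+ 2) i _ (trans (cancel r<2 eq) (*-comm _ (+ 2))))
  where
  n = (+ 2) * i
  r<2 = n%ℕd<d n 2
  eq : n ≡ + (n %ℕ 2) + (n /ℕ 2) * + 2
  eq = a≡a%ℕn+[a/ℕn]*n n 2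
  solve₁ : ∀ i j → (+ 2) * (i - j) ≡ (+ 2) * i - j * + 2
  solve₁ = solve-∀
  solve₂ : ∀ i j → (i + j) - j ≡ i
  solve₂ = solve-∀
  cancel : ∀ {r} → r ℕ.< 2 → n ≡ + r + (n /ℕ 2) * + 2 → n ≡ (n /ℕ 2) * + 2
  cancel {0} _ e = trans e (+-identityˡ _)
  cancel {1} _ e = contradiction (ℕᵈ.∣⇒≤ (∣⇒∣ᵤ (divides {+ 2} {1ℤ} (i - n /ℕ 2)
    (begin
      1ℤ                              ≡⟨ solve₂ 1ℤ (n /ℕ 2 * + 2) ⟨
      (1ℤ + n /ℕ 2 * + 2) - n /ℕ 2 * + 2 ≡⟨ cong (_- n /ℕ 2 * + 2) e ⟨
      n - n /ℕ 2 * + 2                ≡⟨ solve₁ i (n /ℕ 2) ⟨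
      (+ 2) * (i - n /ℕ 2)            ≡⟨ *-comm (+ 2) _ ⟩
      (i - n /ℕ 2) * + 2              ∎)))) (λ { (ℕ.s≤s ()) })
    where open ≡-Reasoning
  cancel {suc (suc _)} (ℕ.s≤s (ℕ.s≤s ()))

2∣i[i-1] : ∀ i → + 2 ∣ i * (i - 1ℤ)
2∣i[i-1] i = subst (λ j → + 2 ∣ j * (j - 1ℤ)) (sym (a≡a%ℕn+[a/ℕn]*n i 2)) (cases (n%ℕd<d i 2) (i /ℕ 2))
  where
  even : ∀ t → (0ℤ + t * + 2) * ((0ℤ + t * + 2) - 1ℤ) ≡ (t * (t * + 2 - 1ℤ)) * + 2
  even = solve-∀
  odd : ∀ t → (1ℤ + t * + 2) * ((1ℤ + t * + 2) - 1ℤ) ≡ ((1ℤ + t * + 2) * t) * + 2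
  odd = solve-∀
  cases : ∀ {r} → r ℕ.< 2 → ∀ t → + 2 ∣ (+ r + t * + 2) * ((+ r + t * + 2) - 1ℤ)
  cases {0} _ t = divides (t * (t * + 2 - 1ℤ)) (even t)
  cases {1} _ t = divides ((1ℤ + t * + 2) * t) (odd t)
  cases {suc (suc _)} (ℕ.s≤s (ℕ.s≤s ()))

0≤+ : ∀ {i j} → 0ℤ ≤ i → 0ℤ ≤ j → 0ℤ ≤ i + j
0≤+ = +-mono-≤

0≤* : ∀ {i j} → 0ℤ ≤ i → 0ℤ ≤ j → 0ℤ ≤ i * j
0≤* {+ m} {+ n} _ _ = subst (0ℤ ≤_) (pos-* m n) (+≤+ ℕ.z≤n)

0≤pos : ∀ {n} → 0ℤ ≤ + n
0≤pos = +≤+ ℕ.z≤n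

0≤i*i : ∀ i → 0ℤ ≤ i * i
0≤i*i (+ n) = 0≤* (0≤pos {n}) (0≤pos {n})
0≤i*i -[1+ n ] = 0≤pos

-- Writing the numerator as k x(x - 1) + 2x shows that it is even, so the floor division is exact.
-- Later computations with `pgon` go through this doubled form.
2*pgon : ∀ k x → + 2 * pgon (2 ℕ.+ k) x ≡ + k * (x * x) - (+ k - + 2) * x
2*pgon k x with 2∣i[i-1] x
... | divides t eq = begin
  + 2 * pgon (2 ℕ.+ k) x                     ≡⟨ cong (λ z → + 2 * (z /ℕ 2)) (numerator (+ k) x) ⟩
  + 2 * ((+ k * (x * (x - 1ℤ)) + + 2 * x) /ℕ 2) ≡⟨ cong (λ z → + 2 * (z /ℕ 2)) twice ⟩
  + 2 * ((+ 2 * (+ k * t + x)) /ℕ 2)         ≡⟨ cong (+ 2 *_) (/2-exact (+ k * t + x)) ⟩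
  + 2 * (+ k * t + x)                        ≡⟨ twice ⟨
  + k * (x * (x - 1ℤ)) + + 2 * x             ≡⟨ rearrange (+ k) x ⟩
  + k * (x * x) - (+ k - + 2) * x            ∎
  where
  open ≡-Reasoning
  rearrange : ∀ k x → k * (x * (x - 1ℤ)) + + 2 * x ≡ k * (x * x) - (k - + 2) * x
  rearrange = solve-∀
  numerator : ∀ k x → ((+ 2 + k - + 2) * (x * x)) - ((+ 2 + k - + 4) * x) ≡ k * (x * (x - 1ℤ)) + + 2 * x
  numerator = solve-∀
  factor : ∀ k t x → k * (t * + 2) + + 2 * x ≡ + 2 * (k * t + x)
  factor = solve-∀
  twice : + k * (x * (x - 1ℤ)) + + 2 * x ≡ + 2 * (+ k * t + x)
  twice = trans (cong (λ z → + k * z + + 2 * x) eq) (factor (+ k) t x)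

pgon-0 : ∀ k → pgon (2 ℕ.+ k) 0ℤ ≡ 0ℤ
pgon-0 k = *-cancelˡ-≡ (+ 2) _ _ (trans (2*pgon k 0ℤ) (vanish (+ k)))
  where
  vanish : ∀ k → k * (0ℤ * 0ℤ) - (k - + 2) * 0ℤ ≡ + 2 * 0ℤ
  vanish = solve-∀

-- Here m = k + 3. The doubled value factors as (n + 1)((k + 1)n + 2) at x = n + 1 and as (n +
-- 1)(k(n + 2) + n) at x = -(n + 1), without negative terms.
pgon-nonNeg : ∀ k x → 0ℤ ≤ pgon (3 ℕ.+ k) x
pgon-nonNeg k x = *-cancelˡ-≤-pos 0ℤ _ (+ 2) (subst (0ℤ ≤_) (sym (2*pgon (suc k) x)) (numerator x))
  where
  at-suc : ∀ k n → (1ℤ + k) * ((1ℤ + n) * (1ℤ + n)) - (1ℤ + k - + 2) * (1ℤ + n) ≡ (1ℤ + n) * ((1ℤ + k) * n + + 2)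
  at-suc = solve-∀
  at-neg : ∀ k n → (1ℤ + k) * (- (1ℤ + n) * - (1ℤ + n)) - (1ℤ + k - + 2) * - (1ℤ + n) ≡ (1ℤ + n) * (k * (+ 2 + n) + n)
  at-neg = solve-∀
  at-0 : ∀ k → (1ℤ + k) * (0ℤ * 0ℤ) - (1ℤ + k - + 2) * 0ℤ ≡ 0ℤ
  at-0 = solve-∀
  numerator : ∀ x → 0ℤ ≤ + suc k * (x * x) - (+ suc k - + 2) * x
  numerator (+ zero) = subst (0ℤ ≤_) (sym (at-0 (+ k))) 0≤pos
  numerator (+ suc n) = subst (0ℤ ≤_) (sym (at-suc (+ k) (+ n)))
    (0≤* {+ suc n} 0≤pos (0≤+ (0≤* {+ suc k} {+ n} 0≤pos 0≤pos) (0≤pos {2})))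
  numerator -[1+ n ] = subst (0ℤ ≤_) (sym (at-neg (+ k) (+ n)))
    (0≤* {+ suc n} 0≤pos (0≤+ (0≤* {+ k} {+ (2 ℕ.+ n)} 0≤pos 0≤pos) (0≤pos {n})))

tri-nonNeg : ∀ k a b c x y z → 0ℤ ≤ tri (3 ℕ.+ k) a b c x y z
tri-nonNeg k a b c x y z = 0≤+ (0≤+ (0≤* {+ a} 0≤pos (pgon-nonNeg k x)) (0≤* {+ b} 0≤pos (pgon-nonNeg k y)))
                               (0≤* {+ c} 0≤pos (pgon-nonNeg k z))

-- Newton iteration over ℤ_p and division by units.

^-suc-∣-* : ∀ p n {u v} → + p ∣ u → + (p ^ n) ∣ v → + (p ^ suc n) ∣ u * v
^-suc-∣-* p n (divides s refl) (divides t refl) =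
  divides (s * t) (trans (regroup s t (+ p) (+ (p ^ n))) (cong (s * t *_) (sym (pos-^ p n))))
  where
  regroup : ∀ s t p q → (s * p) * (t * q) ≡ (s * t) * (p * q)
  regroup = solve-∀

^∣^-suc : ∀ p n → + (p ^ n) ∣ + (p ^ suc n)
^∣^-suc p n = divides (+ p) (pos-^ p n)

-- Newton iteration with the constant slope c.
hensel : ∀ p (f : ℤ → ℤ) c c⁻¹ → + p ∣ 1ℤ - c * c⁻¹ →
  (∀ n x h → + (p ^ n) ∣ h → + (p ^ suc n) ∣ f (x + h) - f x - c * h) →
  ∀ ℓ → ∃ λ (xs : ℕ → ℤ) → (∀ n → + (p ^ n) ∣ xs (suc n) - xs n) × (∀ n → + (p ^ n) ∣ f (xs n) - ℓ)
hensel p f c c⁻¹ inverse linear ℓ = xs , compatible , root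
  where
  step : ℤ → ℤ
  step x = c⁻¹ * (ℓ - f x)
  xs : ℕ → ℤ
  xs zero    = 0ℤ
  xs (suc n) = xs n + step (xs n)
  -- The new error is the linearisation error plus (1 - c c⁻¹) times the old error; `linear` and
  -- `inverse` each supply the extra factor p.
  regroup : ∀ y fx c c⁻¹ ℓ → y - ℓ ≡ (y - fx - c * (c⁻¹ * (ℓ - fx))) + (1ℤ - c * c⁻¹) * (fx - ℓ)
  regroup = solve-∀
  negate : ∀ i j k → i * (k - j) ≡ (- i) * (j - k)
  negate = solve-∀
  difference : ∀ x h → x + h - x ≡ h
  difference = solve-∀
  root : ∀ n → + (p ^ n) ∣ f (xs n) - ℓ
  small : ∀ n → + (p ^ n) ∣ step (xs n)
  small n = subst (+ (p ^ n) ∣_) (sym (negate c⁻¹ (f (xs n)) ℓ)) (∣n⇒∣m*n (- c⁻¹) (root n))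
  root zero    = divides (f 0ℤ - ℓ) (sym (*-identityʳ (f 0ℤ - ℓ)))
  root (suc n) = subst (+ (p ^ suc n) ∣_) (sym (regroup (f (xs n + step (xs n))) (f (xs n)) c c⁻¹ ℓ))
    (∣m∣n⇒∣m+n (linear n (xs n) (step (xs n)) (small n)) (^-suc-∣-* p n inverse (root n)))
  compatible : ∀ n → + (p ^ n) ∣ xs (suc n) - xs n
  compatible n = subst (+ (p ^ n) ∣_) (sym (difference (xs n) (step (xs n)))) (small n)

prime∤⇒coprime : ∀ {p n} → Prime p → ¬ p ℕᵈ.∣ n → Coprime p n
prime∤⇒coprime {p} {n} p-prime p∤n {d} (d∣p , d∣n) with prime⇒irreducible p-prime d∣p
... | inj₁ d≡1 = d≡1
... | inj₂ refl = contradiction d∣n p∤n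

prime∣prime⇒≡ : ∀ {p q} → Prime p → Prime q → p ℕᵈ.∣ q → p ≡ q
prime∣prime⇒≡ p-prime q-prime p∣q with prime⇒irreducible q-prime p∣q
... | inj₁ refl = contradiction p-prime ¬prime[1]
... | inj₂ p≡q = p≡q

inverse-mod-prime : ∀ {p} → Prime p → ∀ {n} → ¬ p ℕᵈ.∣ n → ∃ λ u → + p ∣ 1ℤ - + n * u
inverse-mod-prime {p} p-prime {n} p∤n with coprime-Bézout (prime∤⇒coprime p-prime p∤n)
... | Bézout.+- x y eq = - + y , divides (+ x) (trans (neg (+ n) (+ y)) (trans (cong (λ i → 1ℤ + i) (sym (pos-* y n)))
                          (trans (cong +_ eq) (pos-* x p))))
  where
  neg : ∀ n y → 1ℤ - n * - y ≡ 1ℤ + y * n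
  neg = solve-∀
... | Bézout.-+ x y eq = + y , divides (- + x) (trans (cong (λ i → 1ℤ - i) ny) (cancel (+ x) (+ p)))
  where
  cancel : ∀ x p → 1ℤ - (1ℤ + x * p) ≡ - x * p
  cancel = solve-∀
  ny : + n * + y ≡ 1ℤ + + x * + p
  ny = trans (*-comm (+ n) (+ y)) (trans (sym (pos-* y n)) (trans (cong +_ (sym eq)) (cong (λ i → 1ℤ + i) (pos-* x p))))

-- The map x ↦ d x equals its own linearisation, so the Newton iteration converges to 1/d in ℤ_p.
inverse-padic : ∀ {p} → Prime p → ∀ {d} → ¬ p ℕᵈ.∣ d → ∃ λ (ws : ℕ → ℤ) →
  (∀ n → + (p ^ n) ∣ ws (suc n) - ws n) × (∀ n → + (p ^ n) ∣ + d * ws n - 1ℤ)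
inverse-padic {p} p-prime {d} p∤d =
  let u , inverse = inverse-mod-prime p-prime p∤d in hensel p (+ d *_) (+ d) u inverse linear 1ℤ
  where
  vanish : ∀ d x h → d * (x + h) - d * x - d * h ≡ 0ℤ
  vanish = solve-∀
  linear : ∀ n x h → + (p ^ n) ∣ h → + (p ^ suc n) ∣ + d * (x + h) - + d * x - + d * h
  linear n x h _ = divides 0ℤ (vanish (+ d) x h)

cancel-unit : ∀ d w {q v} → q ∣ d * w - 1ℤ → q ∣ d * v → q ∣ v
cancel-unit d w {q} {v} unit dv = subst (q ∣_) (sym (bezout d w v)) (∣m∣n⇒∣m-n (∣n⇒∣m*n w dv) (∣n⇒∣m*n v unit))
  where
  bezout : ∀ d w v → v ≡ w * (d * v) - v * (d * w - 1ℤ)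
  bezout = solve-∀

cancel-coprime : ∀ {p} → Prime p → ∀ {d} → ¬ p ℕᵈ.∣ d → ∀ n {v} → + (p ^ n) ∣ + d * v → + (p ^ n) ∣ v
cancel-coprime p-prime {d} p∤d n =
  let ws , _ , unit = inverse-padic p-prime p∤d in cancel-unit (+ d) (ws n) (unit n)

-- For p = 2 the cancellation costs one power of p. For odd p the factor 2 is a unit and the power
-- is given away, so that both cases share one statement.
cancel-2 : ∀ {p} → Prime p → ∀ n {v} → + (p ^ suc n) ∣ + 2 * v → + (p ^ n) ∣ v
cancel-2 {p} p-prime n {v} pⁿ⁺¹∣2v with p ℕ.≟ 2
... | yes refl = *-cancelˡ-∣ (+ 2) (subst (_∣ + 2 * v) (pos-^ 2 n) pⁿ⁺¹∣2v)
... | no p≢2 = ∣-trans (^∣^-suc p n) (cancel-coprime p-prime (p≢2 ∘ prime∣prime⇒≡ p-prime prime[2]) (suc n) pⁿ⁺¹∣2v)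

-- Rational points as points over ℤ_p.

-- scaledPgon k d s = 2 d² p_{k+2}(s/d).
scaledPgon : ℕ → ℕ → ℤ → ℤ
scaledPgon k d s = + k * (s * s) - (+ k - + 2) * (s * + d)

-- ℓ is the value of the form at the rational point (s/d, t/d, u/d).
RatRepr : ℕ → ℕ → ℕ → ℕ → ℕ → ℤ → Set
RatRepr d k a b c ℓ = ∃ λ s → ∃ λ t → ∃ λ u →
  + 2 * (+ d * + d) * ℓ ≡ + a * scaledPgon k d s + + b * scaledPgon k d t + + c * scaledPgon k d u

-- As p does not divide d, the point (s/d, t/d, u/d) has p-adic integer coordinates, approximated by
-- s w, t w, u w with w close to 1/d.
ratRepr⇒reprZp : ∀ {p} → Prime p → ∀ d → ¬ p ℕᵈ.∣ d → ∀ k a b c ℓ → RatRepr d k a b c ℓ → ReprZp p (2 ℕ.+ k) a b c ℓ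
ratRepr⇒reprZp {p} p-prime d p∤d k a b c ℓ (s , t , u , point) =
  let ws , compatible , unit = inverse-padic p-prime p∤d in scale ws compatible unit
  where
  module _ (ws : ℕ → ℤ) (compatible : ∀ n → + (p ^ n) ∣ ws (suc n) - ws n) (unit : ∀ n → + (p ^ n) ∣ + d * ws n - 1ℤ) where
    D = + d
    K = + k
    coord : ℤ → ℕ → ℤ
    -- The index runs one ahead: the spare power of p is spent in `cancel-2`.
    coord s n = s * ws (suc n)
    distrib : ∀ s x y → s * x - s * y ≡ s * (x - y)
    distrib = solve-∀
    coord-compatible : ∀ s n → + (p ^ n) ∣ coord s (suc n) - coord s n
    coord-compatible s n = subst (+ (p ^ n) ∣_) (sym (distrib s (ws (suc (suc n))) (ws (suc n))))
      (∣n⇒∣m*n s (∣-trans (^∣^-suc p n) (compatible (suc n))))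

    pull : ∀ D a b c x y z ℓ → D * (D * (+ 2 * (((a * x + b * y) + c * z) - ℓ))) ≡
      D * D * ((a * (+ 2 * x) + b * (+ 2 * y)) + c * (+ 2 * z)) - + 2 * (D * D) * ℓ
    pull = solve-∀
    -- Replacing 1/d by w changes 2 d² p_m(s/d) by a multiple of d w - 1; this is the quotient.
    cofactor : ℤ → ℕ → ℤ
    cofactor s n = K * (s * s) * (D * ws (suc n) + 1ℤ) - (K - + 2) * (s * D)
    factor : ∀ K D w s → D * D * (K * ((s * w) * (s * w)) - (K - + 2) * (s * w)) ≡
      (K * (s * s) - (K - + 2) * (s * D)) + (K * (s * s) * (D * w + 1ℤ) - (K - + 2) * (s * D)) * (D * w - 1ℤ)
    factor = solve-∀
    coord-value : ∀ s n → D * D * (+ 2 * pgon (2 ℕ.+ k) (coord s n)) ≡ scaledPgon k d s + cofactor s n * (D * ws (suc n) - 1ℤ)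
    coord-value s n = trans (cong (λ i → D * D * i) (2*pgon k (coord s n))) (factor K D (ws (suc n)) s)
    collect : ∀ a b c D² x y z f g h f′ g′ h′ ε → D² * x ≡ f + f′ * ε → D² * y ≡ g + g′ * ε → D² * z ≡ h + h′ * ε →
      D² * ((a * x + b * y) + c * z) - (a * f + b * g + c * h) ≡ (a * f′ + b * g′ + c * h′) * ε
    collect a b c D² x y z f g h f′ g′ h′ ε ex ey ez = begin
      D² * ((a * x + b * y) + c * z) - (a * f + b * g + c * h)               ≡⟨ spread a b c D² x y z f g h ⟩
      (a * (D² * x - f) + b * (D² * y - g)) + c * (D² * z - h)               ≡⟨ cong₂ _+_ (cong₂ _+_ (cong (λ i → a * (i - f)) ex) (cong (λ i → b * (i - g)) ey)) (cong (λ i → c * (i - h)) ez) ⟩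
      (a * ((f + f′ * ε) - f) + b * ((g + g′ * ε) - g)) + c * ((h + h′ * ε) - h) ≡⟨ gather a b c f g h f′ g′ h′ ε ⟩
      (a * f′ + b * g′ + c * h′) * ε                                         ∎
      where
      open ≡-Reasoning
      spread : ∀ a b c D² x y z f g h → D² * ((a * x + b * y) + c * z) - (a * f + b * g + c * h) ≡
        (a * (D² * x - f) + b * (D² * y - g)) + c * (D² * z - h)
      spread = solve-∀
      gather : ∀ a b c f g h f′ g′ h′ ε → (a * ((f + f′ * ε) - f) + b * ((g + g′ * ε) - g)) + c * ((h + h′ * ε) - h) ≡
        (a * f′ + b * g′ + c * h′) * ε
      gather = solve-∀
    value : ∀ n → + (p ^ suc n) ∣
      D * (D * (+ 2 * (tri (2 ℕ.+ k) a b c (coord s n) (coord t n) (coord u n) - ℓ)))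
    value n = subst (+ (p ^ suc n) ∣_) (sym (trans
        (pull D (+ a) (+ b) (+ c) (P s) (P t) (P u) ℓ)
        (trans (cong (λ i → D * D * (+ a * (+ 2 * P s) + + b * (+ 2 * P t) + + c * (+ 2 * P u)) - i) point)
          (collect (+ a) (+ b) (+ c) (D * D) (+ 2 * P s) (+ 2 * P t) (+ 2 * P u) (scaledPgon k d s) (scaledPgon k d t) (scaledPgon k d u)
            (cofactor s n) (cofactor t n) (cofactor u n) (D * ws (suc n) - 1ℤ)
            (coord-value s n) (coord-value t n) (coord-value u n)))))
        (∣n⇒∣m*n (+ a * cofactor s n + + b * cofactor t n + + c * cofactor u n) (unit (suc n)))
      where
      P : ℤ → ℤ
      P s = pgon (2 ℕ.+ k) (coord s n)

    scale : ReprZp p (2 ℕ.+ k) a b c ℓ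
    scale = coord s , coord t , coord u ,
      (λ n → ∣⇒∣ᵤ (coord-compatible s n) , ∣⇒∣ᵤ (coord-compatible t n) , ∣⇒∣ᵤ (coord-compatible u n)) ,
      (λ n → ∣⇒∣ᵤ (cancel-2 p-prime n (cancel-unit D (ws (suc n)) (unit (suc n))
               (cancel-unit D (ws (suc n)) (unit (suc n)) (value n)))))

-- Primes at which p_m has slope 1.

-- Slope 1 modulo p at every point: the linearisation hypothesis of `hensel` with c = 1.
PgonExpands : ℕ → ℕ → Set
PgonExpands p k = ∀ n x h → + (p ^ n) ∣ h →
  + (p ^ suc n) ∣ pgon (2 ℕ.+ k) (x + h) - pgon (2 ℕ.+ k) x - h

-- The slope of a p_m is then a, a unit modulo p, so the Newton iteration reaches every ℓ.
pgon-surjective : ∀ {p} → Prime p → ∀ k → PgonExpands p k → ∀ {a} → ¬ p ℕᵈ.∣ a → ∀ ℓ →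
  ∃ λ (xs : ℕ → ℤ) → (∀ n → + (p ^ n) ∣ xs (suc n) - xs n) × (∀ n → + (p ^ n) ∣ + a * pgon (2 ℕ.+ k) (xs n) - ℓ)
pgon-surjective {p} p-prime k expands {a} p∤a =
  let u , inverse = inverse-mod-prime p-prime p∤a in hensel p (λ x → + a * pgon (2 ℕ.+ k) x) (+ a) u inverse linear
  where
  distrib : ∀ a x y h → a * x - a * y - a * h ≡ a * (x - y - h)
  distrib = solve-∀
  linear : ∀ n x h → + (p ^ n) ∣ h →
    + (p ^ suc n) ∣ + a * pgon (2 ℕ.+ k) (x + h) - + a * pgon (2 ℕ.+ k) x - + a * h
  linear n x h pⁿ∣h = subst (+ (p ^ suc n) ∣_) (sym (distrib (+ a) (pgon (2 ℕ.+ k) (x + h)) (pgon (2 ℕ.+ k) x) h)) (∣n⇒∣m*n (+ a) (expands n x h pⁿ∣h))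

-- Primitivity leaves some coefficient prime to p. Its term alone represents ℓ, with the other
-- variables at 0, where p_m vanishes.
reprZp-expanding : ∀ {p} → Prime p → ∀ k → PgonExpands p k → ∀ a b c → gcd (gcd a b) c ≡ 1 →
  ∀ ℓ → ReprZp p (2 ℕ.+ k) a b c ℓ
reprZp-expanding {p} p-prime k expands a b c gcd≡1 ℓ = cases (p ℕᵈ.∣? a) (p ℕᵈ.∣? b) (p ℕᵈ.∣? c)
  where
  P : ℤ → ℤ
  P = pgon (2 ℕ.+ k)
  compatible₀ : ∀ n → 0ℤ ≡[mod p ^ n ] 0ℤ
  compatible₀ n = ∣⇒∣ᵤ {+ (p ^ n)} (divides 0ℤ refl)
  value : ∀ n {i j} → i ≡ j → + (p ^ n) ∣ j - ℓ → i ≡[mod p ^ n ] ℓ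
  value n refl pⁿ∣ = ∣⇒∣ᵤ pⁿ∣
  zeros : ∀ a b z → z ≡ 0ℤ → a * z + b * z ≡ 0ℤ
  zeros a b _ refl = cong₂ _+_ (*-zeroʳ a) (*-zeroʳ b)
  P0 = pgon-0 k
  only-x : ∀ x → tri (2 ℕ.+ k) a b c x 0ℤ 0ℤ ≡ + a * P x
  only-x x = trans (+-assoc (+ a * P x) (+ b * P 0ℤ) (+ c * P 0ℤ))
    (trans (cong (λ i → + a * P x + i) (zeros (+ b) (+ c) (P 0ℤ) P0)) (+-identityʳ (+ a * P x)))
  only-y : ∀ y → tri (2 ℕ.+ k) a b c 0ℤ y 0ℤ ≡ + b * P y
  only-y y = trans (cong (_+ + c * P 0ℤ) (+-comm (+ a * P 0ℤ) (+ b * P y)))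
    (trans (+-assoc (+ b * P y) (+ a * P 0ℤ) (+ c * P 0ℤ))
    (trans (cong (λ i → + b * P y + i) (zeros (+ a) (+ c) (P 0ℤ) P0)) (+-identityʳ (+ b * P y))))
  only-z : ∀ z → tri (2 ℕ.+ k) a b c 0ℤ 0ℤ z ≡ + c * P z
  only-z z = trans (cong (_+ + c * P z) (zeros (+ a) (+ b) (P 0ℤ) P0)) (+-identityˡ (+ c * P z))
  cases : Dec (p ℕᵈ.∣ a) → Dec (p ℕᵈ.∣ b) → Dec (p ℕᵈ.∣ c) → ReprZp p (2 ℕ.+ k) a b c ℓ
  cases (no p∤a) _ _ =
    let xs , compatible , root = pgon-surjective p-prime k expands p∤a ℓ in
    xs , (λ _ → 0ℤ) , (λ _ → 0ℤ) ,
    (λ n → ∣⇒∣ᵤ (compatible n) , compatible₀ n , compatible₀ n) , λ n → value n (only-x (xs n)) (root n)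
  cases (yes _) (no p∤b) _ =
    let ys , compatible , root = pgon-surjective p-prime k expands p∤b ℓ in
    (λ _ → 0ℤ) , ys , (λ _ → 0ℤ) ,
    (λ n → compatible₀ n , ∣⇒∣ᵤ (compatible n) , compatible₀ n) , λ n → value n (only-y (ys n)) (root n)
  cases (yes _) (yes _) (no p∤c) =
    let zs , compatible , root = pgon-surjective p-prime k expands p∤c ℓ in
    (λ _ → 0ℤ) , (λ _ → 0ℤ) , zs ,
    (λ n → compatible₀ n , compatible₀ n , ∣⇒∣ᵤ (compatible n)) , λ n → value n (only-z (zs n)) (root n)
  cases (yes p∣a) (yes p∣b) (yes p∣c) = contradiction (subst Prime (ℕᵈ.∣1⇒≡1 p∣1) p-prime) ¬prime[1]
    where
    p∣1 : p ℕᵈ.∣ 1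
    p∣1 = subst (p ℕᵈ.∣_) gcd≡1 (gcd-greatest (gcd-greatest p∣a p∣b) p∣c)

-- Local representation and the obstruction to regularity.

-- Completing the square: d² times the difference of the two sides of `ReprR` is the sum of a(2ks -
-- (k - 2)d)² and the analogous terms for b, t and c, u.
ratRepr⇒reprR : ∀ d .{{_ : ℕ.NonZero d}} k a b c ℓ → RatRepr d k a b c ℓ → ReprR (2 ℕ.+ k) a b c ℓ
ratRepr⇒reprR d@(suc _) k a b c ℓ (s , t , u , point) =
  0≤i-j⇒j≤i (*-cancelˡ-≤-pos 0ℤ gap (+ d * + d) (subst₂ _≤_ (sym (*-zeroʳ (+ d * + d))) (sym squares)
    (0≤+ (0≤+ (0≤* {+ a} 0≤pos (0≤i*i (X s))) (0≤* {+ b} 0≤pos (0≤i*i (X t)))) (0≤* {+ c} 0≤pos (0≤i*i (X u))))))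
  where
  X : ℤ → ℤ
  X s = + 2 * + k * s - (+ k - + 2) * + d
  pull : ∀ K D a b c ℓ → D * D * (+ 8 * (+ 2 + K - + 2) * ℓ - - ((a + b + c) * ((+ 2 + K - + 4) * (+ 2 + K - + 4))))
    ≡ + 4 * K * (+ 2 * (D * D) * ℓ) + D * D * ((a + b + c) * ((K - + 2) * (K - + 2)))
  pull = solve-∀
  complete : ∀ K D a b c s t u →
    + 4 * K * (a * (K * (s * s) - (K - + 2) * (s * D)) +
               b * (K * (t * t) - (K - + 2) * (t * D)) +
               c * (K * (u * u) - (K - + 2) * (u * D))) + D * D * ((a + b + c) * ((K - + 2) * (K - + 2)))
    ≡ a * ((+ 2 * K * s - (K - + 2) * D) * (+ 2 * K * s - (K - + 2) * D)) +
      b * ((+ 2 * K * t - (K - + 2) * D) * (+ 2 * K * t - (K - + 2) * D)) +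
      c * ((+ 2 * K * u - (K - + 2) * D) * (+ 2 * K * u - (K - + 2) * D))
  complete = solve-∀
  gap = + 8 * (+ (2 ℕ.+ k) - + 2) * ℓ - - ((+ a + + b + + c) * ((+ (2 ℕ.+ k) - + 4) * (+ (2 ℕ.+ k) - + 4)))
  squares : + d * + d * gap
    ≡ + a * (X s * X s) + + b * (X t * X t) + + c * (X u * X u)
  squares = trans (pull (+ k) (+ d) (+ a) (+ b) (+ c) ℓ) (trans
    (cong (λ i → + 4 * + k * i + + d * + d * ((+ a + + b + + c) * ((+ k - + 2) * (+ k - + 2)))) point)
    (complete (+ k) (+ d) (+ a) (+ b) (+ c) s t u))

-- At p = d every integer is represented; at any other prime d is a unit, and the rational point
-- itself serves, as it does over ℝ.
ratRepr⇒locRepr : ∀ {d} → Prime d → ∀ k → PgonExpands d k → ∀ a b c → gcd (gcd a b) c ≡ 1 →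
  ∀ ℓ → RatRepr d k a b c ℓ → LocRepr (2 ℕ.+ k) a b c ℓ
ratRepr⇒locRepr {d} d-prime k expands a b c gcd≡1 ℓ point =
  everywhere , ratRepr⇒reprR d {{prime⇒nonZero d-prime}} k a b c ℓ point
  where
  everywhere : ∀ p → Prime p → ReprZp p (2 ℕ.+ k) a b c ℓ
  everywhere p p-prime with p ℕ.≟ d
  ... | yes refl = reprZp-expanding d-prime k expands a b c gcd≡1 ℓ
  ... | no p≢d = ratRepr⇒reprZp p-prime d (p≢d ∘ prime∣prime⇒≡ p-prime d-prime) k a b c ℓ point

negative-ratRepr⇒¬regular : ∀ {d} → Prime d → ∀ k → PgonExpands d (suc k) → ∀ a b c → gcd (gcd a b) c ≡ 1 →
  ∀ ℓ → ℓ ℤ.< 0ℤ → RatRepr d (suc k) a b c ℓ → ¬ Regular (3 ℕ.+ k) a b c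
negative-ratRepr⇒¬regular d-prime k expands a b c gcd≡1 ℓ ℓ<0 point regular =
  let x , y , z , eq = regular ℓ (ratRepr⇒locRepr d-prime (suc k) expands a b c gcd≡1 ℓ point)
  in <⇒≱ ℓ<0 (subst (0ℤ ≤_) eq (tri-nonNeg k a b c x y z))

-- The slope of p_m at primes dividing k.

-- The deviation from slope 1 carries the factor k h, so a prime dividing k provides the additional
-- power that `PgonExpands` asks for, up to the factor 2 on the left.
twice-increment : ∀ k x h → + 2 * (pgon (2 ℕ.+ k) (x + h) - pgon (2 ℕ.+ k) x - h) ≡ + k * h * (+ 2 * x + h - 1ℤ)
twice-increment k x h = trans (distrib (pgon (2 ℕ.+ k) (x + h)) (pgon (2 ℕ.+ k) x) h) (trans
  (cong₂ (λ i j → i - j - + 2 * h) (2*pgon k (x + h)) (2*pgon k x)) (expand (+ k) x h))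
  where
  distrib : ∀ i j h → + 2 * (i - j - h) ≡ + 2 * i - + 2 * j - + 2 * h
  distrib = solve-∀
  expand : ∀ k x h → (k * ((x + h) * (x + h)) - (k - + 2) * (x + h)) - (k * (x * x) - (k - + 2) * x) - + 2 * h
    ≡ k * h * (+ 2 * x + h - 1ℤ)
  expand = solve-∀

pgonExpands-odd : ∀ {q} → Prime q → q ≢ 2 → ∀ {k} → q ℕᵈ.∣ k → PgonExpands q k
pgonExpands-odd {q} q-prime q≢2 {k} q∣k n x h qⁿ∣h =
  cancel-coprime q-prime (q≢2 ∘ prime∣prime⇒≡ q-prime prime[2]) (suc n)
    (subst (+ (q ^ suc n) ∣_) (sym (twice-increment k x h)) (∣m⇒∣m*n (+ 2 * x + h - 1ℤ) (^-suc-∣-* q n {+ k} (∣ᵤ⇒∣ q∣k) qⁿ∣h)))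

-- One factor 2 of the 4 is used up by the halving; the other raises 2^n to 2^(n+1).
pgonExpands-2 : ∀ {k} → 4 ℕᵈ.∣ k → PgonExpands 2 k
pgonExpands-2 {k} (ℕᵈ.divides e refl) n x h 2ⁿ∣h = subst (+ (2 ^ suc n) ∣_) (sym increment)
    (∣m⇒∣m*n (+ 2 * x + h - 1ℤ) (∣n⇒∣m*n (+ e) (^-suc-∣-* 2 n {+ 2} (divides 1ℤ refl) 2ⁿ∣h)))
  where
  halve : ∀ e h y → e * + 4 * h * y ≡ + 2 * (e * (+ 2 * h) * y)
  halve = solve-∀
  increment : pgon (2 ℕ.+ k) (x + h) - pgon (2 ℕ.+ k) x - h ≡ + e * (+ 2 * h) * (+ 2 * x + h - 1ℤ)
  increment = *-cancelˡ-≡ (+ 2) (pgon (2 ℕ.+ k) (x + h) - pgon (2 ℕ.+ k) x - h) (+ e * (+ 2 * h) * (+ 2 * x + h - 1ℤ))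
    (trans (twice-increment k x h)
    (trans (cong (λ i → i * h * (+ 2 * x + h - 1ℤ)) (pos-* e 4)) (halve (+ e) h (+ 2 * x + h - 1ℤ))))

-- Negative values at half-integral points.

NegRatRepr : ℕ → ℕ → ℕ → ℕ → ℕ → Set
NegRatRepr d k a b c = ∃ λ ℓ → ℓ ℤ.< 0ℤ × RatRepr d k a b c ℓ

swap₁₂ : ∀ {d k a b c} → NegRatRepr d k a b c → NegRatRepr d k b a c
swap₁₂ {d} {k} {a} {b} {c} (ℓ , ℓ<0 , s , t , u , point) =
  ℓ , ℓ<0 , t , s , u , trans point (cong (_+ + c * scaledPgon k d u) (+-comm (+ a * scaledPgon k d s) (+ b * scaledPgon k d t)))

swap₂₃ : ∀ {d k a b c} → NegRatRepr d k a b c → NegRatRepr d k a c b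
swap₂₃ {d} {k} {a} {b} {c} (ℓ , ℓ<0 , s , t , u , point) =
  ℓ , ℓ<0 , s , u , t , trans point (permute (+ a * scaledPgon k d s) (+ b * scaledPgon k d t) (+ c * scaledPgon k d u))
  where
  permute : ∀ x y z → x + y + z ≡ x + z + y
  permute = solve-∀

2∣n⊎2∣1+n : ∀ n → 2 ℕᵈ.∣ n ⊎ 2 ℕᵈ.∣ suc n
2∣n⊎2∣1+n zero = inj₁ (ℕᵈ.divides 0 refl)
2∣n⊎2∣1+n (suc n) with 2∣n⊎2∣1+n n
... | inj₁ (ℕᵈ.divides t refl) = inj₂ (ℕᵈ.divides (suc t) refl)
... | inj₂ 2∣1+n = inj₁ 2∣1+n

odd+odd : ∀ a b → ¬ 2 ℕᵈ.∣ a → ¬ 2 ℕᵈ.∣ b → 2 ℕᵈ.∣ a ℕ.+ b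
odd+odd a b 2∤a 2∤b with 2∣n⊎2∣1+n a | 2∣n⊎2∣1+n b
... | inj₁ 2∣a | _ = contradiction 2∣a 2∤a
... | _ | inj₁ 2∣b = contradiction 2∣b 2∤b
... | inj₂ 2∣1+a | inj₂ 2∣1+b = ℕᵈ.∣m+n∣m⇒∣n
  (subst (2 ℕᵈ.∣_) (cong suc (ℕₚ.+-suc a b)) (ℕᵈ.∣m∣n⇒∣m+n 2∣1+a 2∣1+b)) (ℕᵈ.divides 1 refl)

scaledPgon-0 : ∀ k d → scaledPgon k d 0ℤ ≡ 0ℤ
scaledPgon-0 k d = vanish (+ k) (+ d)
  where
  vanish : ∀ k d → k * (0ℤ * 0ℤ) - (k - + 2) * (0ℤ * d) ≡ 0ℤ
  vanish = solve-∀

-- p_{k+2}(1/2) = (1 - k/4)/2 is negative, so it suffices to find an even subsum of a, b, c.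
negRatRepr-2 : ∀ {k} e → k ≡ suc (suc e) ℕ.* 4 → ∀ a b c → 1 ℕ.≤ a → 1 ℕ.≤ b → NegRatRepr 2 k a b c
negRatRepr-2 {k} e k≡ a b c 1≤a 1≤b = cases (2 ℕᵈ.∣? a) (2 ℕᵈ.∣? b)
  where
  Y = scaledPgon k 2 1ℤ
  Z = scaledPgon k 2 0ℤ
  -- With k = 4(e + 2), 8 p_m(1/2) = k - 2(k - 2) = 4 - k = -4(e + 1).
  scaledPgon-1 : Y ≡ + 4 * - + suc e
  scaledPgon-1 = trans (cong (λ i → i * (1ℤ * 1ℤ) - (i - + 2) * (1ℤ * + 2)) (trans (cong +_ k≡) (pos-* (suc (suc e)) 4)))
              (evaluate (+ suc e))
    where
    evaluate : ∀ e → (1ℤ + e) * + 4 * (1ℤ * 1ℤ) - ((1ℤ + e) * + 4 - + 2) * (1ℤ * + 2) ≡ + 4 * - e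
    evaluate = solve-∀
  -- For an even subsum 2(w + 1), division by 2 d² = 8 leaves ℓ = -(w + 1)(e + 1).
  even : ∀ w {n} → n ≡ suc w ℕ.* 2 → + 2 * (+ 2 * + 2) * - + (suc w ℕ.* suc e) ≡ + n * Y
  even w refl = begin
    + 2 * (+ 2 * + 2) * - + (suc w ℕ.* suc e)       ≡⟨ cong (λ i → + 2 * (+ 2 * + 2) * - i) (pos-* (suc w) (suc e)) ⟩
    + 2 * (+ 2 * + 2) * - (+ suc w * + suc e)     ≡⟨ regroup (+ suc w) (+ suc e) ⟩
    + suc w * + 2 * (+ 4 * - + suc e)             ≡⟨ cong₂ _*_ (sym (pos-* (suc w) 2)) (sym scaledPgon-1) ⟩
    + (suc w ℕ.* 2) * Y                           ∎
    where
    open ≡-Reasoning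
    regroup : ∀ w e → + 2 * (+ 2 * + 2) * - (w * e) ≡ w * + 2 * (+ 4 * - e)
    regroup = solve-∀
  collect : ∀ a b c y z → z ≡ 0ℤ → (a + b) * y ≡ a * y + b * y + c * z
  collect a b c y z refl = distrib a b c y
    where
    distrib : ∀ a b c y → (a + b) * y ≡ a * y + b * y + c * 0ℤ
    distrib = solve-∀
  drop : ∀ a b c y z → z ≡ 0ℤ → a * y ≡ a * y + b * z + c * z
  drop a b c y z refl = pad a b c y
    where
    pad : ∀ a b c y → a * y ≡ a * y + b * 0ℤ + c * 0ℤ
    pad = solve-∀
  evenness : ∀ {n} → 1 ℕ.≤ n → 2 ℕᵈ.∣ n → ∃ λ w → n ≡ suc w ℕ.* 2
  evenness () (ℕᵈ.divides zero refl)
  evenness _ (ℕᵈ.divides (suc w) eq) = w , eq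
  cases : Dec (2 ℕᵈ.∣ a) → Dec (2 ℕᵈ.∣ b) → NegRatRepr 2 k a b c
  cases (yes 2∣a) _ =
    let w , eq = evenness 1≤a 2∣a in
    - + (suc w ℕ.* suc e) , ℤ.-<+ , 1ℤ , 0ℤ , 0ℤ ,
    trans (even w eq) (drop (+ a) (+ b) (+ c) Y Z (scaledPgon-0 k 2))
  cases (no _) (yes 2∣b) =
    let w , eq = evenness 1≤b 2∣b in
    swap₁₂ {2} {k} {b} {a} {c} (- + (suc w ℕ.* suc e) , ℤ.-<+ , 1ℤ , 0ℤ , 0ℤ ,
    trans (even w eq) (drop (+ b) (+ a) (+ c) Y Z (scaledPgon-0 k 2)))
  -- Here a + b is even, so the point is (1/2, 1/2, 0).
  cases (no 2∤a) (no 2∤b) =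
    let w , eq = evenness (ℕₚ.≤-trans 1≤a (ℕₚ.m≤m+n a b)) (odd+odd a b 2∤a 2∤b) in
    - + (suc w ℕ.* suc e) , ℤ.-<+ , 1ℤ , 1ℤ , 0ℤ ,
    trans (even w eq) (collect (+ a) (+ b) (+ c) Y Z (scaledPgon-0 k 2))

-- A pigeonhole argument on a conic modulo q.

euclidsLemma-ℤ : ∀ {p} → Prime p → ∀ i j → + p ∣ i * j → (+ p ∣ i) ⊎ (+ p ∣ j)
euclidsLemma-ℤ p-prime i j p∣ij =
  Sum.map ∣ᵤ⇒∣ ∣ᵤ⇒∣ (euclidsLemma ∣ i ∣ ∣ j ∣ p-prime (subst (_ ℕᵈ.∣_) (abs-* i j) (∣⇒∣ᵤ p∣ij)))

∣∧<⇒≡0 : ∀ {m n} → m ℕᵈ.∣ n → n ℕ.< m → n ≡ 0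
∣∧<⇒≡0 {n = zero} _ _ = refl
∣∧<⇒≡0 {n = suc _} m∣n n<m = contradiction m∣n (ℕᵈ.>⇒∤ n<m)

distinct-residues : ∀ {q i j} → i ℕ.< q → j ℕ.< q → + q ∣ + i - + j → i ≡ j
distinct-residues {q} {i} {j} i<q j<q q∣i-j = +-injective (i-j≡0⇒i≡j (+ i) (+ j) (∣i∣≡0⇒i≡0
  (∣∧<⇒≡0 (∣⇒∣ᵤ q∣i-j) (subst (ℕ._< q) (cong ∣_∣ (sym ([+m]-[+n]≡m⊖n i j)))
    (ℕₚ.≤-<-trans (∣m⊝n∣≤m⊔n i j) (ℕₚ.⊔-lub i<q j<q))))))

-- For k = e q this is the class modulo q of 2 q p_m(s/q) = s(e(s - q) + 2).
reducedMod : ℕ → ℤ → ℤ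
reducedMod e s = s * (+ e * s + + 2)

-- For e prime to q this parabola is symmetric about -1/e mod q; otherwise it is linear mod q.
reducedMod-injective-on-half : ∀ h → let q = suc (h ℕ.+ h) in Prime q → ¬ q ℕᵈ.∣ 2 → ∀ e → ∃ λ s₀ →
  ∀ i j → i ℕ.≤ h → j ℕ.≤ h → + q ∣ reducedMod e (s₀ + + i) - reducedMod e (s₀ + + j) → i ≡ j
reducedMod-injective-on-half h q-prime q∤2 e = cases (q ℕᵈ.∣? e)
  where
  q = suc (h ℕ.+ h)
  ≤h⇒<q : ∀ {i} → i ℕ.≤ h → i ℕ.< q
  ≤h⇒<q i≤h = ℕ.s≤s (ℕₚ.≤-trans i≤h (ℕₚ.m≤m+n h h))
  -- By Euclid's lemma a coincidence of values forces q to divide i - j or the second factor; `s₀`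
  -- is chosen so that the latter is impossible unless i = j.
  factor : ∀ e s i j → (s + i) * (e * (s + i) + + 2) - (s + j) * (e * (s + j) + + 2) ≡
    (i - j) * (e * (i + j) + + 2 * (e * s + 1ℤ))
  factor = solve-∀
  cases : Dec (q ℕᵈ.∣ e) → _
  cases (yes q∣e) = 0ℤ , injective
    where
    injective : ∀ i j → i ℕ.≤ h → j ℕ.≤ h → + q ∣ reducedMod e (0ℤ + + i) - reducedMod e (0ℤ + + j) → i ≡ j
    injective i j i≤h j≤h q∣ =
      [ distinct-residues (≤h⇒<q i≤h) (≤h⇒<q j≤h) , (λ q∣2 → contradiction (∣⇒∣ᵤ (linear q∣2)) q∤2) ]′
      (euclidsLemma-ℤ q-prime (+ i - + j) (+ e * (+ i + + j) + + 2 * (+ e * 0ℤ + 1ℤ))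
        (subst (+ q ∣_) (factor (+ e) 0ℤ (+ i) (+ j)) q∣))
      where
      linear : + q ∣ + e * (+ i + + j) + + 2 * (+ e * 0ℤ + 1ℤ) → + q ∣ + 2
      linear q∣sum = ∣m+n∣m⇒∣n {+ q} {+ e * (+ i + + j)}
        (subst (λ z → + q ∣ + e * (+ i + + j) + + 2 * (z + 1ℤ)) (*-zeroʳ (+ e)) q∣sum)
        (∣m⇒∣m*n (+ i + + j) (∣ᵤ⇒∣ {+ q} {+ e} q∣e))
  -- The start -u is -1/e modulo q, the axis of the parabola, so the second factor becomes e(i + j).
  -- As i + j ≤ 2h < q, only i = j = 0 remains.
  cases (no q∤e) = let u , inverse = inverse-mod-prime q-prime q∤e in - u , injective u inverse
    where
    module _ (u : ℤ) (inverse : + q ∣ 1ℤ - + e * u) where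
      q∣eu-1 : + q ∣ + e * - u + 1ℤ
      q∣eu-1 = subst (+ q ∣_) (rearrange (+ e) u) inverse
        where
        rearrange : ∀ e u → 1ℤ - e * u ≡ e * - u + 1ℤ
        rearrange = solve-∀
      injective : ∀ i j → i ℕ.≤ h → j ℕ.≤ h → + q ∣ reducedMod e (- u + + i) - reducedMod e (- u + + j) → i ≡ j
      injective i j i≤h j≤h q∣ =
        [ distinct-residues (≤h⇒<q i≤h) (≤h⇒<q j≤h) , symmetric ]′
        (euclidsLemma-ℤ q-prime (+ i - + j) (+ e * (+ i + + j) + + 2 * (+ e * - u + 1ℤ))
          (subst (+ q ∣_) (factor (+ e) (- u) (+ i) (+ j)) q∣))
        where
        q∣i+j⇒i≡j : + q ∣ + i + + j → i ≡ j
        q∣i+j⇒i≡j q∣i+j = trans (ℕₚ.m+n≡0⇒m≡0 i i+j≡0) (sym (ℕₚ.m+n≡0⇒n≡0 i i+j≡0))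
          where
          i+j≡0 : i ℕ.+ j ≡ 0
          i+j≡0 = ∣∧<⇒≡0 (∣⇒∣ᵤ q∣i+j) (ℕ.s≤s (ℕₚ.+-mono-≤ i≤h j≤h))
        symmetric : + q ∣ + e * (+ i + + j) + + 2 * (+ e * - u + 1ℤ) → i ≡ j
        symmetric q∣sum = [ (λ q∣e → contradiction (∣⇒∣ᵤ q∣e) q∤e) , q∣i+j⇒i≡j ]′
          (euclidsLemma-ℤ q-prime (+ e) (+ i + + j)
            (∣m+n∣n⇒∣m {+ q} {+ e * (+ i + + j)} q∣sum (∣n⇒∣m*n (+ 2) q∣eu-1)))

residue : ∀ q .{{_ : ℕ.NonZero q}} → ℤ → Fin q
residue q z = fromℕ< (n%ℕd<d z q)

residue-≡⇒∣ : ∀ q .{{_ : ℕ.NonZero q}} y z → residue q y ≡ residue q z → + q ∣ y - z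
residue-≡⇒∣ q y z eq = divides (y /ℕ q - z /ℕ q) (begin
  y - z ≡⟨ cong₂ _-_ (a≡a%ℕn+[a/ℕn]*n y q) (a≡a%ℕn+[a/ℕn]*n z q) ⟩
  (+ (y %ℕ q) + y /ℕ q * + q) - (+ (z %ℕ q) + z /ℕ q * + q)
    ≡⟨ cong (λ r → (+ r + y /ℕ q * + q) - (+ (z %ℕ q) + z /ℕ q * + q)) same ⟩
  (+ (z %ℕ q) + y /ℕ q * + q) - (+ (z %ℕ q) + z /ℕ q * + q)
    ≡⟨ cancel (+ (z %ℕ q)) (y /ℕ q) (z /ℕ q) (+ q) ⟩
  (y /ℕ q - z /ℕ q) * + q ∎)
  where
  open ≡-Reasoning
  cancel : ∀ r s t q → (r + s * q) - (r + t * q) ≡ (s - t) * q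
  cancel = solve-∀
  same : y %ℕ q ≡ z %ℕ q
  same = trans (sym (Finₚ.toℕ-fromℕ< (n%ℕd<d y q))) (trans (cong toℕ eq) (Finₚ.toℕ-fromℕ< (n%ℕd<d z q)))

-- Cauchy's pigeonhole: a·reducedMod and r − b·reducedMod each take (q + 1)/2 values mod q.
conic-point : ∀ h → let q = suc (h ℕ.+ h) in Prime q → ¬ q ℕᵈ.∣ 2 → ∀ e a b → ¬ q ℕᵈ.∣ a → ¬ q ℕᵈ.∣ b → ∀ r →
  ∃₂ λ s t → + q ∣ + a * reducedMod e s + + b * reducedMod e t - r
conic-point h q-prime q∤2 e a b q∤a q∤b r =
  let s₀ , injective = reducedMod-injective-on-half h q-prime q∤2 e in pigeons s₀ injective
  where
  q = suc (h ℕ.+ h)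
  module _ (s₀ : ℤ) (injective : ∀ i j → i ℕ.≤ h → j ℕ.≤ h → + q ∣ reducedMod e (s₀ + + i) - reducedMod e (s₀ + + j) → i ≡ j) where
    σ : Fin (suc h) → ℤ
    σ i = s₀ + + toℕ i
    value : Fin (suc h) ⊎ Fin (suc h) → ℤ
    value (inj₁ i) = + a * reducedMod e (σ i)
    value (inj₂ j) = r - + b * reducedMod e (σ j)
    bound : (i : Fin (suc h)) → toℕ i ℕ.≤ h
    bound i = ℕ.s≤s⁻¹ (Finₚ.toℕ<n i)
    distrib₁ : ∀ a x y → a * x - a * y ≡ a * (x - y)
    distrib₁ = solve-∀
    distrib₂ : ∀ b r x y → (r - b * x) - (r - b * y) ≡ b * (y - x)
    distrib₂ = solve-∀
    mixed : ∀ a b x y r → a * x - (r - b * y) ≡ a * x + b * y - r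
    mixed = solve-∀
    same-half : ∀ c → ¬ q ℕᵈ.∣ c → ∀ i j → + q ∣ + c * (reducedMod e (σ i) - reducedMod e (σ j)) → i ≡ j
    same-half c q∤c i j q∣ = [ (λ q∣c → contradiction (∣⇒∣ᵤ q∣c) q∤c) , Finₚ.toℕ-injective ∘ injective (toℕ i) (toℕ j) (bound i) (bound j) ]′
      (euclidsLemma-ℤ q-prime (+ c) (reducedMod e (σ i) - reducedMod e (σ j)) q∣)
    collision : ∀ x y → x ≢ y → + q ∣ value x - value y → ∃₂ λ s t → + q ∣ + a * reducedMod e s + + b * reducedMod e t - r
    collision (inj₁ i) (inj₁ j) x≢y q∣ = contradiction
      (cong inj₁ (same-half a q∤a i j (subst (+ q ∣_) (distrib₁ (+ a) (reducedMod e (σ i)) (reducedMod e (σ j))) q∣))) x≢y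
    collision (inj₂ i) (inj₂ j) x≢y q∣ = contradiction
      (cong inj₂ (sym (same-half b q∤b j i (subst (+ q ∣_) (distrib₂ (+ b) r (reducedMod e (σ i)) (reducedMod e (σ j))) q∣)))) x≢y
    collision (inj₁ i) (inj₂ j) _ q∣ = σ i , σ j , subst (+ q ∣_) (mixed (+ a) (+ b) (reducedMod e (σ i)) (reducedMod e (σ j)) r) q∣
    collision (inj₂ i) (inj₁ j) _ q∣ = σ j , σ i , subst (+ q ∣_)
      (trans (negate (r - + b * reducedMod e (σ i)) (+ a * reducedMod e (σ j))) (mixed (+ a) (+ b) (reducedMod e (σ j)) (reducedMod e (σ i)) r)) (∣m⇒∣-m q∣)
      where
      negate : ∀ x y → - (x - y) ≡ y - x
      negate = solve-∀
    conclude : _ → ∃₂ λ s t → + q ∣ + a * reducedMod e s + + b * reducedMod e t - r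
    conclude (i , j , i<j , eq) = collision (splitAt (suc h) i) (splitAt (suc h) j)
      (λ same → Finₚ.<⇒≢ i<j (trans (sym (Finₚ.join-splitAt (suc h) (suc h) i)) (trans (cong (join (suc h) (suc h)) same) (Finₚ.join-splitAt (suc h) (suc h) j))))
      (residue-≡⇒∣ q (value (splitAt (suc h) i)) (value (splitAt (suc h) j)) eq)
    pigeons : ∃₂ λ s t → + q ∣ + a * reducedMod e s + + b * reducedMod e t - r
    -- There are 2(h + 1) = q + 1 indices and q residues. Injectivity excludes a collision within
    -- one half, so the colliding values come from different halves.
    pigeons = conclude (Finₚ.pigeonhole (ℕ.s≤s (ℕₚ.≤-reflexive (sym (ℕₚ.+-suc h h)))) (residue q ∘ value ∘ splitAt (suc h)))

-- Reduction to [0, q) keeps the congruence and puts s and t in the range where the size bound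
-- `reduced-upper` applies.
conic-point-reduced : ∀ h → let q = suc (h ℕ.+ h) in Prime q → ¬ q ℕᵈ.∣ 2 → ∀ e a b → ¬ q ℕᵈ.∣ a → ¬ q ℕᵈ.∣ b → ∀ r →
  ∃₂ λ s t → s ℕ.< q × t ℕ.< q × + q ∣ + a * reducedMod e (+ s) + + b * reducedMod e (+ t) - r
conic-point-reduced h q-prime q∤2 e a b q∤a q∤b r =
  let s , t , q∣ = conic-point h q-prime q∤2 e a b q∤a q∤b r in
  s %ℕ q , t %ℕ q , n%ℕd<d s q , n%ℕd<d t q ,
  ∣m+n∣n⇒∣m {+ q} {+ a * reducedMod e (+ (s %ℕ q)) + + b * reducedMod e (+ (t %ℕ q)) - r}
    (subst (+ q ∣_) (regroup (+ a) (+ b) (reducedMod e s) (reducedMod e t) (reducedMod e (+ (s %ℕ q))) (reducedMod e (+ (t %ℕ q))) r) q∣)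
    (∣m∣n⇒∣m+n (∣n⇒∣m*n (+ a) (shift s)) (∣n⇒∣m*n (+ b) (shift t)))
  where
  q = suc (h ℕ.+ h)
  regroup : ∀ a b x y x′ y′ r → a * x + b * y - r ≡ (a * x′ + b * y′ - r) + (a * (x - x′) + b * (y - y′))
  regroup = solve-∀
  factor : ∀ e s y q → (s + y * q) * (e * (s + y * q) + + 2) - s * (e * s + + 2) ≡ y * (e * (+ 2 * s + y * q) + + 2) * q
  factor = solve-∀
  shift : ∀ s → + q ∣ reducedMod e s - reducedMod e (+ (s %ℕ q))
  shift s = divides (s /ℕ q * (+ e * (+ 2 * + (s %ℕ q) + s /ℕ q * + q) + + 2))
    (trans (cong (λ z → reducedMod e z - reducedMod e (+ (s %ℕ q))) (a≡a%ℕn+[a/ℕn]*n s q)) (factor (+ e) (+ (s %ℕ q)) (s /ℕ q) (+ q)))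

-- Negative values at points with denominator q.

-- With k = e q, reduced q e s = 2 q p_{k+2}(s/q), which is congruent to reducedMod e s mod q.
reduced : ℕ → ℕ → ℤ → ℤ
reduced q e s = s * (+ e * (s - + q) + + 2)

-- The second sum W is 2q times the value of the form at (s/q, t/q, u/q). It agrees with the first
-- sum modulo q, hence is divisible by q, and it is even because q is odd; so the value is an
-- integer with the sign of W.
negRatRepr-q : ∀ h → let q = suc (h ℕ.+ h) in Prime q → ¬ q ℕᵈ.∣ 2 → ∀ e a b c s t u →
  + q ∣ + a * reducedMod e s + + b * reducedMod e t + + c * reducedMod e u →
  + a * reduced q e s + + b * reduced q e t + + c * reduced q e u ℤ.< 0ℤ →
  NegRatRepr q (e ℕ.* q) a b c
negRatRepr-q h q-prime q∤2 e a b c s t u q∣f W<0 = descend 2∣W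
  where
  q = suc (h ℕ.+ h)
  W = + a * reduced q e s + + b * reduced q e t + + c * reduced q e u
  reduced-even : ∀ s → + 2 ∣ reduced q e s
  reduced-even s = subst (+ 2 ∣_) (sym (rearrange (+ e) s (+ h)))
    (∣m∣n⇒∣m+n (∣n⇒∣m*n (+ e) (2∣i[i-1] s)) (divides (s - + e * + h * s) refl))
    where
    rearrange : ∀ e s h → s * (e * (s - (1ℤ + (h + h))) + + 2) ≡ e * (s * (s - 1ℤ)) + (s - e * h * s) * + 2
    rearrange = solve-∀
  2∣W : + 2 ∣ W
  2∣W = ∣m∣n⇒∣m+n (∣m∣n⇒∣m+n (∣n⇒∣m*n (+ a) (reduced-even s)) (∣n⇒∣m*n (+ b) (reduced-even t))) (∣n⇒∣m*n (+ c) (reduced-even u))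
  q∣W : + q ∣ W
  q∣W = subst (+ q ∣_) (sym (rearrange (+ a) (+ b) (+ c) (+ e) (+ q) s t u))
    (∣m∣n⇒∣m-n q∣f (divides (+ e * (+ a * s + + b * t + + c * u)) refl))
    where
    rearrange : ∀ a b c e q s t u →
      a * (s * (e * (s - q) + + 2)) + b * (t * (e * (t - q) + + 2)) + c * (u * (e * (u - q) + + 2)) ≡
      (a * (s * (e * s + + 2)) + b * (t * (e * t + + 2)) + c * (u * (e * u + + 2))) - e * (a * s + b * t + c * u) * q
    rearrange = solve-∀
  conclude : ∀ V → W ≡ V * + 2 → + q ∣ V → NegRatRepr q (e ℕ.* q) a b c
  conclude V W≡ (divides ℓ V≡) = ℓ , ≰⇒> (λ 0≤ℓ → <⇒≱ W<0 (subst (0ℤ ≤_) (sym W≡ℓ) (0≤* (0≤* 0≤ℓ (0≤pos {q})) (0≤pos {2})))) ,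
    s , t , u , (begin
      + 2 * (+ q * + q) * ℓ     ≡⟨ regroup (+ q) ℓ ⟩
      + q * (ℓ * + q * + 2)     ≡⟨ cong (+ q *_) W≡ℓ ⟨
      + q * W                   ≡⟨ expand (+ a) (+ b) (+ c) (+ e) (+ q) s t u ⟩
      rhs (+ e * + q)           ≡⟨ cong rhs (pos-* e q) ⟨
      rhs (+ (e ℕ.* q))         ∎)
    where
    open ≡-Reasoning
    W≡ℓ : W ≡ ℓ * + q * + 2
    W≡ℓ = trans W≡ (cong (_* + 2) V≡)
    regroup : ∀ q ℓ → + 2 * (q * q) * ℓ ≡ q * (ℓ * q * + 2)
    regroup = solve-∀
    rhs : ℤ → ℤ
    rhs k = + a * (k * (s * s) - (k - + 2) * (s * + q)) + + b * (k * (t * t) - (k - + 2) * (t * + q))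
          + + c * (k * (u * u) - (k - + 2) * (u * + q))
    expand : ∀ a b c e q s t u →
      q * (a * (s * (e * (s - q) + + 2)) + b * (t * (e * (t - q) + + 2)) + c * (u * (e * (u - q) + + 2))) ≡
      a * (e * q * (s * s) - (e * q - + 2) * (s * q)) + b * (e * q * (t * t) - (e * q - + 2) * (t * q))
        + c * (e * q * (u * u) - (e * q - + 2) * (u * q))
    expand = solve-∀
  descend : + 2 ∣ W → NegRatRepr q (e ℕ.* q) a b c
  descend (divides V W≡) = [ conclude V W≡ , (λ q∣2 → contradiction (∣⇒∣ᵤ q∣2) q∤2) ]′
    (euclidsLemma-ℤ q-prime V (+ 2) (subst (+ q ∣_) W≡ q∣W))

-- The value is h(2 - e(h + 1)). The bound 7 makes it at most -5h, enough to offset two terms of at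
-- most 2h each with h to spare.
reduced-at-half : ∀ h e {E} → e ℕ.* suc h ≡ 7 ℕ.+ E → reduced (suc (h ℕ.+ h)) e (+ h) ≡ - (+ h * (+ 5 + + E))
reduced-at-half h e {E} eq = trans (expand (+ h) (+ e))
  (trans (cong (λ i → + h * (+ 2 - i)) (trans (sym (pos-* e (suc h))) (cong +_ eq))) (simplify (+ h) (+ E)))
  where
  expand : ∀ h e → h * (e * (h - (1ℤ + (h + h))) + + 2) ≡ h * (+ 2 - e * (1ℤ + h))
  expand = solve-∀
  simplify : ∀ h E → h * (+ 2 - (+ 7 + E)) ≡ - (h * (+ 5 + E))
  simplify = solve-∀

-- For 0 ≤ s < q the subtracted product (e + 1)(q - s) is at least 1, so the value is at most s,
-- hence at most 2h. `N` is the deficit.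
reduced-upper : ∀ h e s → s ℕ.< suc (h ℕ.+ h) → ∃ λ N → reduced (suc (h ℕ.+ h)) (suc e) (+ s) ≡ + 2 * + h - + N
reduced-upper h e s (ℕ.s≤s s≤2h) with ℕₚ.m≤n⇒∃[o]m+o≡n s≤2h
... | r , s+r≡2h = r ℕ.+ s ℕ.* (r ℕ.+ (e ℕ.+ e ℕ.* r)) , (begin
  + s * (+ suc e * (+ s - + suc (h ℕ.+ h)) + + 2)
    ≡⟨ cong (λ n → + s * (+ suc e * (+ s - + suc n) + + 2)) s+r≡2h ⟨
  + s * (+ suc e * (+ s - + suc (s ℕ.+ r)) + + 2)
    ≡⟨ expand (+ e) (+ s) (+ r) ⟩
  (+ s + + r) - (+ r + + s * (+ r + (+ e + + e * + r)))
    ≡⟨ cong₂ _-_ 2h (cong (λ i → + r + i) cast) ⟩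
  + 2 * + h - + (r ℕ.+ s ℕ.* (r ℕ.+ (e ℕ.+ e ℕ.* r))) ∎)
  where
  open ≡-Reasoning
  expand : ∀ e s r → s * ((1ℤ + e) * (s - (1ℤ + (s + r))) + + 2) ≡ (s + r) - (r + s * (r + (e + e * r)))
  expand = solve-∀
  double : ∀ h → h + h ≡ + 2 * h
  double = solve-∀
  2h : + s + + r ≡ + 2 * + h
  2h = trans (cong +_ s+r≡2h) (double (+ h))
  cast : + s * (+ r + (+ e + + e * + r)) ≡ + (s ℕ.* (r ℕ.+ (e ℕ.+ e ℕ.* r)))
  cast = trans (cong (λ i → + s * (+ r + (+ e + i))) (sym (pos-* e r))) (sym (pos-* s (r ℕ.+ (e ℕ.+ e ℕ.* r))))

module OddPrime (h′ e′ : ℕ) (q-prime : Prime (suc (suc h′ ℕ.+ suc h′))) (q∤2 : ¬ suc (suc h′ ℕ.+ suc h′) ℕᵈ.∣ 2)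
  (large : 7 ℕ.≤ suc e′ ℕ.* suc (suc h′)) where

  private
    h = suc h′
    e = suc e′
    q = suc (h ℕ.+ h)
    E = proj₁ (ℕₚ.m≤n⇒∃[o]m+o≡n large)
    E-eq : e ℕ.* suc h ≡ 7 ℕ.+ E
    E-eq = sym (proj₂ (ℕₚ.m≤n⇒∃[o]m+o≡n large))

  -- The point (h/q, 0, 0) suffices: q ∣ a gives the congruence, and p_m(h/q) is negative.
  divisible : ∀ a b c → 1 ℕ.≤ a → q ℕᵈ.∣ a → NegRatRepr q (e ℕ.* q) a b c
  divisible a@(suc _) b c _ q∣a = negRatRepr-q h q-prime q∤2 e a b c (+ h) 0ℤ 0ℤ
    (subst (+ q ∣_) (drop (+ a) (reducedMod e (+ h)) (+ b) (+ c)) (∣m⇒∣m*n (reducedMod e (+ h)) (∣ᵤ⇒∣ {+ q} {+ a} q∣a)))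
    (subst (ℤ._< 0ℤ) (sym negative) ℤ.-<+)
    where
    drop : ∀ a x b c → a * x ≡ a * x + b * 0ℤ + c * 0ℤ
    drop = solve-∀
    neg : ∀ a h y → a * - (h * y) ≡ - (a * (h * y))
    neg = solve-∀
    negative : + a * reduced q e (+ h) + + b * reduced q e 0ℤ + + c * reduced q e 0ℤ ≡ - + (a ℕ.* (h ℕ.* (5 ℕ.+ E)))
    negative = begin
      + a * reduced q e (+ h) + + b * 0ℤ + + c * 0ℤ ≡⟨ drop (+ a) (reduced q e (+ h)) (+ b) (+ c) ⟨
      + a * reduced q e (+ h)                       ≡⟨ cong (+ a *_) (reduced-at-half h e E-eq) ⟩
      + a * - (+ h * (+ 5 + + E))             ≡⟨ neg (+ a) (+ h) (+ 5 + + E) ⟩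
      - (+ a * (+ h * (+ 5 + + E)))           ≡⟨ cong (λ i → - (+ a * i)) (pos-* h (5 ℕ.+ E)) ⟨
      - (+ a * + (h ℕ.* (5 ℕ.+ E)))           ≡⟨ cong -_ (pos-* a (h ℕ.* (5 ℕ.+ E))) ⟨
      - + (a ℕ.* (h ℕ.* (5 ℕ.+ E)))           ∎
      where open ≡-Reasoning

  -- The largest coefficient takes the most negative value, which beats the other two terms.
  negative : ∀ a b c s t → 1 ℕ.≤ c → a ℕ.≤ c → b ℕ.≤ c → s ℕ.< q → t ℕ.< q →
    + a * reduced q e (+ s) + + b * reduced q e (+ t) + + c * reduced q e (+ h) ℤ.< 0ℤ
  negative a b c@(suc c′) s t _ a≤c b≤c s<q t<q =
    let N , gs = reduced-upper h e′ s s<q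
        M , gt = reduced-upper h e′ t t<q
        a′ , a-eq = ℕₚ.m≤n⇒∃[o]m+o≡n a≤c
        b′ , b-eq = ℕₚ.m≤n⇒∃[o]m+o≡n b≤c
    in ≤-<-trans (0≤i-j⇒j≤i (subst (0ℤ ≤_)
         (sym (trans (cong (λ i → - + (h ℕ.* c) - i) (cong₂ _+_ (cong₂ _+_ (cong (+ a *_) gs) (cong (+ b *_) gt)) (cong (+ c *_) (reduced-at-half h e E-eq))))
                     (slack a′ b′ N M a-eq b-eq)))
         (0≤+ (0≤+ (0≤+ (0≤+ (0≤* (0≤* {+ h} {+ c} 0≤pos 0≤pos) (0≤pos {E})) (0≤* {+ a} {+ N} 0≤pos 0≤pos))
                   (0≤* {+ b} {+ M} 0≤pos 0≤pos)) (0≤* (0≤* {+ 2} {+ h} 0≤pos 0≤pos) (0≤pos {a′})))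
              (0≤* (0≤* {+ 2} {+ h} 0≤pos 0≤pos) (0≤pos {b′})))))
       ℤ.-<+
    where
    -- The sum is compared with -hc: the last term is at most -5hc, and the bounds 2ha and 2hb of
    -- the others are at most 2hc each. The gap is an explicit sum of nonnegative terms.
    slack : ∀ a′ b′ N M → a ℕ.+ a′ ≡ c → b ℕ.+ b′ ≡ c →
      - + (h ℕ.* c) - (+ a * (+ 2 * + h - + N) + + b * (+ 2 * + h - + M) + + c * - (+ h * (+ 5 + + E))) ≡
      + h * + c * + E + + a * + N + + b * + M + + 2 * + h * + a′ + + 2 * + h * + b′
    slack a′ b′ N M a-eq b-eq = begin
      - + (h ℕ.* c) - X                         ≡⟨ cong (λ i → - i - X) (pos-* h c) ⟩
      - (+ h * + c) - X                         ≡⟨ identity (+ a) (+ b) (+ c) (+ h) (+ N) (+ M) (+ E) ⟩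
      Y + + 2 * + h * (+ c - + a) + + 2 * + h * (+ c - + b)
        ≡⟨ cong₂ (λ i j → Y + + 2 * + h * i + + 2 * + h * j) (difference a a′ a-eq) (difference b b′ b-eq) ⟩
      Y + + 2 * + h * + a′ + + 2 * + h * + b′   ∎
      where
      open ≡-Reasoning
      X = + a * (+ 2 * + h - + N) + + b * (+ 2 * + h - + M) + + c * - (+ h * (+ 5 + + E))
      Y = + h * + c * + E + + a * + N + + b * + M
      identity : ∀ a b c h N M E → - (h * c) - (a * (+ 2 * h - N) + b * (+ 2 * h - M) + c * - (h * (+ 5 + E))) ≡
        h * c * E + a * N + b * M + + 2 * h * (c - a) + + 2 * h * (c - b)
      identity = solve-∀
      cancel : ∀ x y → (x + y) - x ≡ y
      cancel = solve-∀
      difference : ∀ x x′ → x ℕ.+ x′ ≡ c → + c - + x ≡ + x′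
      difference x x′ eq = trans (cong (_- + x) (cong +_ (sym eq))) (cancel (+ x) (+ x′))

  largest-last : ∀ a b c → 1 ℕ.≤ a → 1 ℕ.≤ b → 1 ℕ.≤ c → a ℕ.≤ c → b ℕ.≤ c → NegRatRepr q (e ℕ.* q) a b c
  largest-last a b c 1≤a 1≤b 1≤c a≤c b≤c = cases (q ℕᵈ.∣? a) (q ℕᵈ.∣? b)
    where
    cases : Dec (q ℕᵈ.∣ a) → Dec (q ℕᵈ.∣ b) → NegRatRepr q (e ℕ.* q) a b c
    cases (yes q∣a) _ = divisible a b c 1≤a q∣a
    cases (no _) (yes q∣b) = swap₁₂ {q} {e ℕ.* q} {b} {a} {c} (divisible b a c 1≤b q∣b)
    cases (no q∤a) (no q∤b) =
      -- The third coordinate is fixed at h/q beforehand, so its term becomes the target residue for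
      -- the other two.
      let s , t , s<q , t<q , q∣ = conic-point-reduced h q-prime q∤2 e a b q∤a q∤b (- (+ c * reducedMod e (+ h)))
      in negRatRepr-q h q-prime q∤2 e a b c (+ s) (+ t) (+ h)
           (subst (+ q ∣_) (double-neg (+ a * reducedMod e (+ s) + + b * reducedMod e (+ t)) (+ c * reducedMod e (+ h))) q∣)
           (negative a b c s t 1≤c a≤c b≤c s<q t<q)
      where
      double-neg : ∀ x y → x - - y ≡ x + y
      double-neg = solve-∀

  negRatRepr-odd : ∀ a b c → 1 ℕ.≤ a → 1 ℕ.≤ b → 1 ℕ.≤ c → NegRatRepr q (e ℕ.* q) a b c
  negRatRepr-odd a b c 1≤a 1≤b 1≤c = [ (λ a≤b → [ b≤c a≤b , c≤b a≤b ]′ (ℕₚ.≤-total b c)) , (λ b≤a → [ a≤c b≤a , c≤a b≤a ]′ (ℕₚ.≤-total a c)) ]′ (ℕₚ.≤-total a b)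
    where
    k = e ℕ.* q
    b≤c : a ℕ.≤ b → b ℕ.≤ c → NegRatRepr q k a b c
    b≤c a≤b b≤c = largest-last a b c 1≤a 1≤b 1≤c (ℕₚ.≤-trans a≤b b≤c) b≤c
    c≤b : a ℕ.≤ b → c ℕ.≤ b → NegRatRepr q k a b c
    c≤b a≤b c≤b = swap₂₃ {q} {k} {a} {c} {b} (largest-last a c b 1≤a 1≤c 1≤b a≤b c≤b)
    a≤c : b ℕ.≤ a → a ℕ.≤ c → NegRatRepr q k a b c
    a≤c b≤a a≤c = largest-last a b c 1≤a 1≤b 1≤c a≤c (ℕₚ.≤-trans b≤a a≤c)
    c≤a : b ℕ.≤ a → c ℕ.≤ a → NegRatRepr q k a b c
    c≤a b≤a c≤a = swap₁₂ {q} {k} {b} {a} {c} (swap₂₃ {q} {k} {b} {c} {a} (largest-last b c a 1≤b 1≤c 1≤a b≤a c≤a))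

-- Choice of the prime and conclusion.

prime-factor : ∀ n → 1 ℕ.< n → ∃ λ q → Prime q × q ℕᵈ.∣ n
prime-factor n@(suc _) 1<n with factorise n
... | record { factors = [] ; isFactorisation = n≡1 } = contradiction (sym n≡1) (ℕₚ.<⇒≢ 1<n)
... | record { factors = q ∷ qs ; isFactorisation = n≡ ; factorsPrime = q-prime ∷ _ } =
  q , q-prime , subst (q ℕᵈ.∣_) (sym n≡) (ℕᵈ.m∣m*n (product qs))

-- If n = 2t, then t > 1 because n > 2, and t is odd because 4 does not divide n; any prime factor
-- of t works.
odd-prime-factor : ∀ n → 2 ℕ.< n → ¬ 4 ℕᵈ.∣ n → ∃ λ q → Prime q × q ≢ 2 × q ℕᵈ.∣ n
odd-prime-factor n 2<n 4∤n with 2 ℕᵈ.∣? n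
... | no 2∤n =
  let q , q-prime , q∣n = prime-factor n (ℕₚ.<-trans ℕₚ.≤-refl 2<n)
  in q , q-prime , (λ q≡2 → 2∤n (subst (ℕᵈ._∣ n) q≡2 q∣n)) , q∣n
... | yes (ℕᵈ.divides t refl) =
  let q , q-prime , q∣t = prime-factor t (ℕₚ.*-cancelʳ-< 2 1 t 2<n)
  in q , q-prime , (λ q≡2 → 4∤n (ℕᵈ.*-monoˡ-∣ 2 (subst (ℕᵈ._∣ t) q≡2 q∣t))) , ℕᵈ.∣m⇒∣m*n 2 q∣t

n*2≡n+n : ∀ n → n ℕ.* 2 ≡ n ℕ.+ n
n*2≡n+n n = trans (ℕₚ.*-comm n 2) (cong (λ m → n ℕ.+ m) (ℕₚ.+-identityʳ n))

odd-prime⇒1+2h : ∀ {q} → Prime q → q ≢ 2 → ∃ λ h → q ≡ suc (suc h ℕ.+ suc h)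
odd-prime⇒1+2h {q} q-prime q≢2 = cases (2∣n⊎2∣1+n q)
  where
  cases : 2 ℕᵈ.∣ q ⊎ 2 ℕᵈ.∣ suc q → ∃ λ h → q ≡ suc (suc h ℕ.+ suc h)
  cases (inj₁ 2∣q) = contradiction (sym (prime∣prime⇒≡ prime[2] q-prime 2∣q)) q≢2
  cases (inj₂ (ℕᵈ.divides (suc zero) refl)) = contradiction q-prime ¬prime[1]
  cases (inj₂ (ℕᵈ.divides (suc (suc h)) eq)) = h , trans (ℕₚ.suc-injective eq)
    (cong (suc ∘ suc) (trans (cong suc (n*2≡n+n h)) (sym (ℕₚ.+-suc h h))))

¬regular : ∀ k → 14 ℕ.≤ suc k → ∀ a b c → 1 ℕ.≤ a → 1 ℕ.≤ b → 1 ℕ.≤ c → gcd (gcd a b) c ≡ 1 → ¬ Regular (3 ℕ.+ k) a b c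
¬regular k 14≤k a b c 1≤a 1≤b 1≤c gcd≡1 = cases (4 ℕᵈ.∣? suc k)
  where
  conclude : ∀ {d} → Prime d → PgonExpands d (suc k) → NegRatRepr d (suc k) a b c → ¬ Regular (3 ℕ.+ k) a b c
  conclude d-prime expands (ℓ , ℓ<0 , point) = negative-ratRepr⇒¬regular d-prime k expands a b c gcd≡1 ℓ ℓ<0 point
  odd : ∀ q → Prime q → q ≢ 2 → q ℕᵈ.∣ suc k → NegRatRepr q (suc k) a b c
  odd q q-prime q≢2 (ℕᵈ.divides (suc e) k≡) with odd-prime⇒1+2h q-prime q≢2
  ... | h , refl = subst (λ n → NegRatRepr q n a b c) (sym k≡)
    (OddPrime.negRatRepr-odd h e q-prime (q≢2 ∘ prime∣prime⇒≡ q-prime prime[2]) large a b c 1≤a 1≤b 1≤c)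
    where
    large : 7 ℕ.≤ suc e ℕ.* suc (suc h)
    -- The cofactor times q = 2h + 1 is at least 14 and q ≤ 2(h + 1), so the cofactor times h + 1 is
    -- at least 7.
    large = ℕₚ.*-cancelʳ-≤ 7 (suc e ℕ.* suc (suc h)) 2 (begin
      14                               ≤⟨ 14≤k ⟩
      suc k                            ≡⟨ k≡ ⟩
      suc e ℕ.* suc (suc h ℕ.+ suc h)  ≤⟨ ℕₚ.*-monoʳ-≤ (suc e) q≤ ⟩
      suc e ℕ.* (suc (suc h) ℕ.* 2)    ≡⟨ ℕₚ.*-assoc (suc e) (suc (suc h)) 2 ⟨
      suc e ℕ.* suc (suc h) ℕ.* 2      ∎)
      where
      open ℕₚ.≤-Reasoning
      q≤ : suc (suc h ℕ.+ suc h) ℕ.≤ suc (suc h) ℕ.* 2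
      q≤ = subst (suc (suc h ℕ.+ suc h) ℕ.≤_) (sym (n*2≡n+n (suc (suc h)))) (ℕ.s≤s (ℕₚ.+-monoʳ-≤ (suc h) (ℕₚ.n≤1+n (suc h))))
  cases : Dec (4 ℕᵈ.∣ suc k) → ¬ Regular (3 ℕ.+ k) a b c
  -- The quotient by 4 must be at least 2: for quotient 1, excluded below by size, p_m(1/2) would be
  -- 0 and not negative.
  cases (yes 4∣k@(ℕᵈ.divides (suc (suc e)) k≡)) =
    conclude prime[2] (pgonExpands-2 4∣k) (negRatRepr-2 e k≡ a b c 1≤a 1≤b)
  cases (yes (ℕᵈ.divides 1 refl)) = contradiction 14≤k (ℕₚ.<⇒≱ (ℕₚ.m≤m+n 5 9))
  cases (no 4∤k) =
    let q , q-prime , q≢2 , q∣k = odd-prime-factor (suc k) (ℕₚ.≤-trans (ℕₚ.m≤m+n 3 11) 14≤k) 4∤k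
    in conclude q-prime (pgonExpands-odd q-prime q≢2 q∣k) (odd q q-prime q≢2 q∣k)

theorem1p2 : ∃ λ (C : ℕ) → ∀ (m : ℕ) → 3 ℕ.≤ m → C ℕ.< m →
    ∀ (a b c : ℕ) → 1 ℕ.≤ a → 1 ℕ.≤ b → 1 ℕ.≤ c → gcd (gcd a b) c ≡ 1 →
    ¬ Regular m a b c
-- `suc k` is m - 2, so m > 15 says exactly that 14 ≤ m - 2.
theorem1p2 = 15 , λ { (suc (suc (suc k))) (ℕ.s≤s (ℕ.s≤s (ℕ.s≤s ℕ.z≤n))) 15<m → ¬regular k (ℕ.s≤s⁻¹ (ℕ.s≤s⁻¹ 15<m)) }
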